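{- Let $p$ be a prime and let $D\in\mathbb{Z}$ be an integer that is not a perfect square and such that $D$ is a quadratic residue modulo $p$ with $p\nmid D$ if $p$ is odd, and $D\equiv 1 \pmod 8$ if $p=2$. Let $\sqrt{D}\in\mathbb{Q}_p$ denote a square root of $D$ in $\mathbb{Q}_p$. If $D<0$, then the Ruban continued fraction expansion of the $p$-adic number $\sqrt{D}$ is not ultimately periodic.
   Context: $|\cdot|_p$ is the $p$-adic absolute value on $\mathbb{Q}_p$ with $|p|_p=1/p$. The $p$-adic floor function $\lfloor\cdot\rfloor_p:\mathbb{Q}_p\to\mathbb{Q}$ is defined, for $\alpha=\sum_{n=m}^{\infty}c_np^n$ with $c_n\in\{0,\ldots,p-1\}$, $m\in\mathbb{Z}$, $c_m\ne0$, by $\lfloor\alpha\rfloor_p=\sum_{n=m}^{0}c_np^n$ if $m\le 0$ and $\lfloor\alpha\rfloor_p=0$ if $m>0$ (and $\lfloor 0\rfloor_p=0$). The Ruban continued fraction expansion of $\alpha\in\mathbb{Q}_p$ is $[a_0,a_1,a_2,\ldots]$, where $\alpha_0=\alpha$, $a_n=\lfloor\alpha_n\rfloor_p$, and, as long as $\alpha_n\neq a_n$, $\alpha_{n+1}=1/(\alpha_n-a_n)$; the process stops if $\alpha_n=a_n$ (this never happens when $\alpha$ is irrational). The expansion is ultimately periodic if it is infinite and there exist integers $k\ge0$ and $l\ge1$ such that $a_{n+l}=a_n$ for all $n\ge k$. -}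

module Defs where

open import Data.Nat.Base as ℕ using (ℕ; zero; suc)
import Data.Nat.DivMod as ℕ
import Data.Nat.Properties as ℕ
open import Data.Nat.Primality using (Prime; prime⇒nonZero)
open import Data.Integer.Base as ℤ using (ℤ; +_; 1ℤ)
open import Data.Integer.DivMod using (_%ℕ_)
import Data.Integer.Properties as ℤ
open import Data.Integer.Divisibility.Signed
  using (_∣_; divides; ∣m∣n⇒∣m+n; ∣m⇒∣-m; ∣m⇒∣m*n; ∣n⇒∣m*n)
open import Data.Integer.Tactic.RingSolver using (solve-∀)
open import Data.Rational.Base as ℚ using (ℚ)
open import Data.Product.Base using (Σ; ∃-syntax; _×_)
open import Relation.Binary.PropositionalEquality using (_≡_; subst)

infix 4 _≡_[mod_]
_≡_[mod_] : ℤ → ℤ → ℤ → Set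
a ≡ b [mod m ] = m ∣ a ℤ.- b

IsPerfectSquare : ℤ → Set
IsPerfectSquare a = ∃[ b ] a ≡ b ℤ.* b

IsQuadraticResidue : ℤ → ℤ → Set
IsQuadraticResidue a m = ∃[ b ] b ℤ.* b ≡ a [mod m ]

module PAdic (p : ℕ) (p-prime : Prime p) where

  p^n≢0 : ∀ n → ℕ.NonZero (p ℕ.^ n)
  p^n≢0 n = ℕ.m^n≢0 p n {{prime⇒nonZero p-prime}}

  -- ℤₚ is the inverse limit of the rings ℤ/pⁿ: the n-th approximation is an
  -- integer that matters only modulo pⁿ.
  record ℤₚ : Set where
    field
      approx   : ℕ → ℤ
      coherent : ∀ n → approx (suc n) ≡ approx n [mod + (p ℕ.^ n) ]

  open ℤₚ public

  infix 4 _≈ℤₚ_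
  _≈ℤₚ_ : ℤₚ → ℤₚ → Set
  x ≈ℤₚ y = ∀ n → approx x n ≡ approx y n [mod + (p ℕ.^ n) ]

  constℤₚ : ℤ → ℤₚ
  constℤₚ a .approx   _ = a
  constℤₚ a .coherent n = divides ℤ.0ℤ (ℤ.+-inverseʳ a)

  infixl 6 _+ℤₚ_
  _+ℤₚ_ : ℤₚ → ℤₚ → ℤₚ
  (x +ℤₚ y) .approx   n = approx x n ℤ.+ approx y n
  (x +ℤₚ y) .coherent n =
    subst (+ (p ℕ.^ n) ∣_) (lemma (approx x (suc n)) (approx x n) (approx y (suc n)) (approx y n))
      (∣m∣n⇒∣m+n (coherent x n) (coherent y n))
    where
    lemma : ∀ a b c d → (a ℤ.- b) ℤ.+ (c ℤ.- d) ≡ (a ℤ.+ c) ℤ.- (b ℤ.+ d)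
    lemma = solve-∀

  -ℤₚ_ : ℤₚ → ℤₚ
  (-ℤₚ x) .approx   n = ℤ.- approx x n
  (-ℤₚ x) .coherent n =
    subst (+ (p ℕ.^ n) ∣_) (lemma (approx x (suc n)) (approx x n)) (∣m⇒∣-m (coherent x n))
    where
    lemma : ∀ a b → ℤ.- (a ℤ.- b) ≡ (ℤ.- a) ℤ.- (ℤ.- b)
    lemma = solve-∀

  infixl 7 _*ℤₚ_
  _*ℤₚ_ : ℤₚ → ℤₚ → ℤₚ
  (x *ℤₚ y) .approx   n = approx x n ℤ.* approx y n
  (x *ℤₚ y) .coherent n =
    subst (+ (p ℕ.^ n) ∣_) (lemma (approx x (suc n)) (approx x n) (approx y (suc n)) (approx y n))
      (∣m∣n⇒∣m+n (∣m⇒∣m*n (approx y (suc n)) (coherent x n))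
                 (∣n⇒∣m*n (approx x n) (coherent y n)))
    where
    lemma : ∀ a b c d → (a ℤ.- b) ℤ.* c ℤ.+ b ℤ.* (c ℤ.- d) ≡ a ℤ.* c ℤ.- b ℤ.* d
    lemma = solve-∀

  -- The coefficient cₙ ∈ {0,…,p-1} in x = Σ cₙ pⁿ, read off from x modulo pⁿ⁺¹.
  digit : ℤₚ → ℕ → ℕ
  digit x n = (approx x (suc n) %ℕ (p ℕ.^ suc n)) ℕ./ (p ℕ.^ n)
    where instance
      _ = p^n≢0 n
      _ = p^n≢0 (suc n)

  -- Σ_{i<n} cᵢ pⁱ
  truncate : ℤₚ → ℕ → ℕ
  truncate x zero    = 0
  truncate x (suc n) = truncate x n ℕ.+ digit x n ℕ.* p ℕ.^ n

  p^_·_ : ℕ → ℤₚ → ℤₚ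
  p^ k · x = constℤₚ (+ (p ℕ.^ k)) *ℤₚ x

  -- ℚₚ = ℤₚ[1/p]; x /p^ k stands for x · p⁻ᵏ, and x need not be prime to p.
  infix 8 _/p^_
  record ℚₚ : Set where
    constructor _/p^_
    field
      numₚ : ℤₚ
      expₚ : ℕ

  infix 4 _≈_
  _≈_ : ℚₚ → ℚₚ → Set
  x /p^ k ≈ y /p^ l = p^ l · x ≈ℤₚ p^ k · y

  infixl 6 _+_ _-_
  infixl 7 _*_

  _+_ : ℚₚ → ℚₚ → ℚₚ
  x /p^ k + y /p^ l = ((p^ l · x) +ℤₚ (p^ k · y)) /p^ (k ℕ.+ l)

  -_ : ℚₚ → ℚₚ
  - (x /p^ k) = (-ℤₚ x) /p^ k

  _-_ : ℚₚ → ℚₚ → ℚₚ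
  α - β = α + (- β)

  _*_ : ℚₚ → ℚₚ → ℚₚ
  x /p^ k * y /p^ l = (x *ℤₚ y) /p^ (k ℕ.+ l)

  fromℤ : ℤ → ℚₚ
  fromℤ a = constℤₚ a /p^ 0

  -- The values of the floor function lie in ℤ[1/p], the common subring of ℚ
  -- and ℚₚ: a [1/p^ k ] stands for a · p⁻ᵏ, seen in either field below.
  record ℤ[1/p] : Set where
    constructor _[1/p^_]
    field
      num : ℤ
      exp : ℕ

  toℚ : ℤ[1/p] → ℚ
  toℚ (a [1/p^ k ]) = a ℚ./ (p ℕ.^ k)
    where instance _ = p^n≢0 k

  toℚₚ : ℤ[1/p] → ℚₚ
  toℚₚ (a [1/p^ k ]) = constℤₚ a /p^ k

  -- If x = Σ cᵢ pⁱ, the terms of x · p⁻ᵏ with exponent ≤ 0 are those with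
  -- i ≤ k. Leading zero digits contribute nothing, so the valuation is not needed.
  floor : ℚₚ → ℤ[1/p]
  floor (x /p^ k) = (+ truncate x (suc k)) [1/p^ k ]

  ⌊_⌋ₚ : ℚₚ → ℚ
  ⌊ α ⌋ₚ = toℚ (floor α)

  -- An infinite Ruban expansion of α, given by its complete quotients αₙ. The
  -- equation (αₙ - aₙ) αₙ₊₁ = 1 says both that αₙ ≠ aₙ, so that the process
  -- does not stop at step n, and that αₙ₊₁ = 1/(αₙ - aₙ).
  record InfiniteRubanExpansion (α : ℚₚ) : Set where
    field
      complete : ℕ → ℚₚ
      start    : complete 0 ≈ α
      step     : ∀ n → (complete n - toℚₚ (floor (complete n))) * complete (suc n) ≈ fromℤ 1ℤ

    partialQuotient : ℕ → ℚ
    partialQuotient n = ⌊ complete n ⌋ₚ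

  -- The complete quotients are unique up to _≈_ (inverses are unique and the floor
  -- respects _≈_), so it does not matter which e is given.
  HasUltimatelyPeriodicRubanExpansion : ℚₚ → Set
  HasUltimatelyPeriodicRubanExpansion α =
    Σ (InfiniteRubanExpansion α) λ e → let open InfiniteRubanExpansion e in
      ∃[ k ] ∃[ l ] 1 ℕ.≤ l × (∀ n → k ℕ.≤ n → partialQuotient (n ℕ.+ l) ≡ partialQuotient n)

{-# OPTIONS --safe #-}
module Submission where

-- Suppose that the Ruban expansion of α, where α² = D < 0, is ultimately periodic.
--
-- A complete quotient is determined p-adically by the partial quotients that follow:
-- two numbers with the same floor differ by much less than their successors do
-- (difference-divisible). So periodicity of the partial quotients makes two complete
-- quotients equal, αₘ = αₘ₊ₗ, and m ≥ 1 may be assumed.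
--
-- The partial quotients are nonnegative rationals, and positive from index 1 on. Composing
-- the relations αₙ = aₙ + 1 / αₙ₊₁ over one period yields αₘ = (A αₘ + B) / (C αₘ + E) with
-- A, B, C > 0 and E ≥ 0 (tail-möbius). Hence αₘ is a root of C z² + (E - A) z - B, whose
-- discriminant (E - A)² + 4 B C is positive (möbius-fixed). The relations between αₙ and
-- αₙ₊₁ change discriminants of quadratic equations by nonzero squares only, so that α too
-- is a root of a rational quadratic polynomial of positive discriminant
-- (indefiniteRoot-0). But α satisfies z² = D, and a number with negative rational square
-- satisfies no such equation (indefiniteRoot-square≮0).
--
-- After clearing denominators every relation is an equation between p-adic integers with
-- integer coefficients. It is written as divisibility by pᴺ of an integer expression in the
-- N-th approximations, for all N, and derived as an explicit combination of others.

open import Defs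
open import Data.Nat.Base as ℕ using (ℕ; zero; suc)
import Data.Nat.DivMod as ℕ
import Data.Nat.Divisibility as ℕ using (∣⇒≤)
import Data.Nat.Properties as ℕ
import Data.Nat.Tactic.RingSolver as ℕRing
open import Data.Nat.Divisibility using () renaming (_∣_ to _∣ℕ_)
open import Data.Nat.Primality using (Prime; prime⇒nonZero; prime⇒nonTrivial)
open import Data.Integer.Base as ℤ
  using (ℤ; +_; -[1+_]; 0ℤ; 1ℤ; _<_; _≤_; +≤+; +<+)
open import Data.Integer.DivMod using (_%ℕ_; _/ℕ_; n%ℕd<d; a≡a%ℕn+[a/ℕn]*n)
open import Data.Integer.Divisibility.Signed
open import Data.Integer.Tactic.RingSolver using (solve-∀)
import Data.Integer.Properties as ℤ
import Data.Rational.Properties as ℚ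
open import Data.Product.Base using (_×_; _,_)
open import Data.Sum.Base using (inj₁; inj₂)
open import Data.Empty using (⊥-elim)
open import Relation.Nullary.Negation.Core using (¬_)
open import Relation.Binary.PropositionalEquality
  using (_≡_; refl; sym; trans; cong; cong₂; subst; module ≡-Reasoning)

-- Signs, discriminants and residues of integers

module IntegerLemmas where

  open import Data.Integer.Base using (_+_; _-_; _*_; -_)

  private
    variable
      i j m : ℤ

  0≤i*i : ∀ i → 0ℤ ≤ i * i
  0≤i*i (+ n)    = subst (0ℤ ≤_) (ℤ.pos-* n n) (+≤+ ℕ.z≤n)
  0≤i*i -[1+ n ] = +≤+ ℕ.z≤n

  0<i*j : 0ℤ < i → 0ℤ < j → 0ℤ < i * j
  0<i*j {i} {j} 0<i 0<j =
    subst (_< i * j) (ℤ.*-zeroʳ i) (ℤ.*-monoˡ-<-pos i {{ℤ.positive 0<i}} 0<j)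

  0≤i*j : 0ℤ ≤ i → 0ℤ ≤ j → 0ℤ ≤ i * j
  0≤i*j {i} {j} 0≤i 0≤j =
    subst (_≤ i * j) (ℤ.*-zeroʳ i) (ℤ.*-monoˡ-≤-nonNeg i {{ℤ.nonNegative 0≤i}} 0≤j)

  -- The discriminant of the polynomial c z² + b z + a; the constant coefficient comes first.
  disc : ℤ → ℤ → ℤ → ℤ
  disc a b c = b * b - + 4 * (a * c)

  -- The equation says that c z² + b z + a, reduced by z² = g to (c g + a) + b z, has
  -- norm zero over ℤ. Then disc · g = (c g - a)² ≥ 0, so disc > 0 is impossible if g < 0.
  conjugate-roots⇒disc≤0 : ∀ a b c g → g < 0ℤ → (c * g + a) * (c * g + a) ≡ b * b * g →
                            ¬ 0ℤ < disc a b c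
  conjugate-roots⇒disc≤0 a b c g g<0 eq 0<d =
    ℤ.<-irrefl refl (ℤ.≤-<-trans (0≤i*i (c * g - a)) neg)
    where
    square : ∀ a b c g → (c * g - a) * (c * g - a) ≡
      (b * b - + 4 * (a * c)) * g + ((c * g + a) * (c * g + a) - b * b * g)
    square = solve-∀

    eq′ : (c * g - a) * (c * g - a) ≡ disc a b c * g
    eq′ = trans (square a b c g)
      (trans (cong (λ s → disc a b c * g + s) (ℤ.i≡j⇒i-j≡0 eq)) (ℤ.+-identityʳ _))

    neg : (c * g - a) * (c * g - a) < 0ℤ
    neg = subst (_< 0ℤ) (sym eq′)
      (subst (disc a b c * g <_) (ℤ.*-zeroʳ (disc a b c))
        (ℤ.*-monoˡ-<-pos (disc a b c) {{ℤ.positive 0<d}} g<0))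

  ∣-resp-≡ : i ≡ j → m ∣ j → m ∣ i
  ∣-resp-≡ {m = m} eq = subst (m ∣_) (sym eq)

  ∣0 : ∀ m → m ∣ 0ℤ
  ∣0 m = divides 0ℤ refl

  ≡⇒∣- : i ≡ j → m ∣ i - j
  ≡⇒∣- {i} {j} {m} eq = ∣-resp-≡ (ℤ.i≡j⇒i-j≡0 eq) (∣0 m)

  %ℕ-cong : ∀ a b d .{{_ : ℕ.NonZero d}} → a ≡ b [mod + d ] → a %ℕ d ≡ b %ℕ d
  %ℕ-cong a b d h = residue-unique (n%ℕd<d a d) (n%ℕd<d b d)
    (∣-resp-≡ rearrange (∣m∣n⇒∣m+n h (∣n⇒∣m*n (b /ℕ d - a /ℕ d) ∣-refl)))
    where
    identity : ∀ r s u v d → r - s ≡ ((r + u * d) - (s + v * d)) + (v - u) * d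
    identity = solve-∀

    rearrange : + (a %ℕ d) - + (b %ℕ d) ≡ (a - b) + (b /ℕ d - a /ℕ d) * + d
    rearrange = trans (identity (+ (a %ℕ d)) (+ (b %ℕ d)) (a /ℕ d) (b /ℕ d) (+ d))
      (cong₂ (λ y z → (y - z) + (b /ℕ d - a /ℕ d) * + d)
        (sym (a≡a%ℕn+[a/ℕn]*n a d)) (sym (a≡a%ℕn+[a/ℕn]*n b d)))

    ordered : ∀ {r s} → r ℕ.≤ s → s ℕ.< d → + r ≡ + s [mod + d ] → r ≡ s
    ordered {r} {s} r≤s s<d d∣ = ℕ.≤-antisym r≤s (ℕ.m∸n≡0⇒m≤n (small _
      (ℕ.≤-<-trans (ℕ.m∸n≤m s r) s<d)
      (subst (d ∣ℕ_) (trans (cong ℤ.∣_∣ (ℤ.m-n≡m⊖n r s)) (ℤ.∣⊖∣-≤ r≤s)) (∣⇒∣ᵤ d∣))))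
      where
      small : ∀ n → n ℕ.< d → d ∣ℕ n → n ≡ 0
      small zero    _   _ = refl
      small (suc n) n<d d∣n = ⊥-elim (ℕ.<⇒≱ n<d (ℕ.∣⇒≤ d∣n))

    residue-unique : ∀ {r s} → r ℕ.< d → s ℕ.< d → + r ≡ + s [mod + d ] → r ≡ s
    residue-unique {r} {s} r<d s<d h with ℕ.≤-total r s
    ... | inj₁ r≤s = ordered r≤s s<d h
    ... | inj₂ s≤r = sym (ordered s≤r r<d (∣-resp-≡ (swap (+ s) (+ r)) (∣m⇒∣-m h)))
      where
      swap : ∀ a b → a - b ≡ - (b - a)
      swap = solve-∀

module PAdicLemmas (p : ℕ) (p-prime : Prime p) where

  open import Data.Integer.Base using (_+_; _-_; _*_; -_)
  open IntegerLemmas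

  open PAdic p p-prime
    using (ℤₚ; approx; coherent; constℤₚ; _*ℤₚ_; _+ℤₚ_; -ℤₚ_; p^_·_; p^n≢0; digit; truncate;
           ℚₚ; _≈_; fromℤ; InfiniteRubanExpansion;
           HasUltimatelyPeriodicRubanExpansion)
  open ℚₚ
  private module ℚₚ′ = PAdic p p-prime
  open InfiniteRubanExpansion

  private instance
    p≢0 : ℕ.NonZero p
    p≢0 = prime⇒nonZero p-prime

  1<p : 1 ℕ.< p
  1<p = ℕ.nonTrivial⇒n>1 p {{prime⇒nonTrivial p-prime}}

  -- Powers of p and the approximations of a p-adic integer

  -- The powers of p, as integers.
  P : ℕ → ℤ
  P n = + (p ℕ.^ n)

  0<P : ∀ n → 0ℤ < P n
  0<P n = +<+ (ℕ.m^n>0 p n)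

  P-+ : ∀ m n → P (m ℕ.+ n) ≡ P m * P n
  P-+ m n = trans (cong +_ (ℕ.^-distribˡ-+-* p m n)) (ℤ.pos-* (p ℕ.^ m) (p ℕ.^ n))

  P∣P : ∀ {m n} → m ℕ.≤ n → P m ∣ P n
  P∣P {m} {n} m≤n = divides (P (n ℕ.∸ m))
    (trans (cong P (sym (ℕ.m∸n+n≡m m≤n))) (P-+ (n ℕ.∸ m) m))

  P∣-* : ∀ m n {i j} → P m ∣ i → P n ∣ j → P (m ℕ.+ n) ∣ i * j
  P∣-* m n {i} {j} m∣i n∣j = subst (_∣ i * j) (sym (P-+ m n))
    (∣-trans (*-monoˡ-∣ (P n) m∣i) (*-monoʳ-∣ i n∣j))

  P∣-cancel : ∀ m n {i} → P (m ℕ.+ n) ∣ P m * i → P n ∣ i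
  P∣-cancel m n {i} h = *-cancelˡ-∣ (P m) {{p^n≢0 m}} (subst (_∣ P m * i) (P-+ m n) h)

  n<p^n : ∀ n → n ℕ.< p ℕ.^ n
  n<p^n zero    = ℕ.s≤s ℕ.z≤n
  n<p^n (suc n) = ℕ.≤-<-trans (n<p^n n) (ℕ.^-monoʳ-< p 1<p (ℕ.n<1+n n))

  -- The map from ℤ to ℤₚ is injective.
  P∣-all⇒≡0 : ∀ {i} → (∀ n → P n ∣ i) → i ≡ 0ℤ
  P∣-all⇒≡0 {i} h = ℤ.∣i∣≡0⇒i≡0 (zero-abs ℤ.∣ i ∣ (∣⇒∣ᵤ (h ℤ.∣ i ∣)))
    where
    zero-abs : ∀ n → p ℕ.^ n ∣ℕ n → n ≡ 0
    zero-abs zero    _   = refl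
    zero-abs (suc n) p∣n = ⊥-elim (ℕ.<⇒≱ (n<p^n (suc n)) (ℕ.∣⇒≤ p∣n))

  approx-stable : ∀ z {n N} → n ℕ.≤ N → approx z N ≡ approx z n [mod P n ]
  approx-stable z {n} {N} n≤N =
    subst (λ M → approx z M ≡ approx z n [mod P n ]) (ℕ.m∸n+n≡m n≤N) (go (N ℕ.∸ n))
    where
    identity : ∀ a b c → a - c ≡ (a - b) + (b - c)
    identity = solve-∀

    go : ∀ d → approx z (d ℕ.+ n) ≡ approx z n [mod P n ]
    go zero    = ≡⇒∣- {approx z n} refl
    go (suc d) = ∣-resp-≡ (identity (approx z (suc d ℕ.+ n)) (approx z (d ℕ.+ n)) (approx z n))
      (∣m∣n⇒∣m+n (∣-trans (P∣P (ℕ.m≤n+m n d)) (coherent z (d ℕ.+ n))) (go d))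

  -- Divisibility of a p-adic integer by pⁿ, decided by its n-th approximation: the
  -- valuation of z is at least n. Any later approximation decides it equally well.
  p^_∣ₚ_ : ℕ → ℤₚ → Set
  p^ n ∣ₚ z = P n ∣ approx z n

  ∣ₚ⇒∣approx : ∀ z {n N} → n ℕ.≤ N → p^ n ∣ₚ z → P n ∣ approx z N
  ∣ₚ⇒∣approx z {n} {N} n≤N h =
    ∣-resp-≡ (identity (approx z N) (approx z n)) (∣m∣n⇒∣m+n (approx-stable z n≤N) h)
    where
    identity : ∀ a b → a ≡ (a - b) + b
    identity = solve-∀

  ∣approx⇒∣ₚ : ∀ z {n N} → n ℕ.≤ N → P n ∣ approx z N → p^ n ∣ₚ z
  ∣approx⇒∣ₚ z {n} {N} n≤N h =
    ∣-resp-≡ (identity (approx z N) (approx z n)) (∣m∣n⇒∣m-n h (approx-stable z n≤N))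
    where
    identity : ∀ a b → b ≡ a - (a - b)
    identity = solve-∀

  ∣ₚ-weaken : ∀ z {m n} → m ℕ.≤ n → p^ n ∣ₚ z → p^ m ∣ₚ z
  ∣ₚ-weaken z {m} {n} m≤n h = ∣approx⇒∣ₚ z m≤n (∣-trans (P∣P m≤n) h)

  -- ℤₚ has no p-torsion: if pᶜ z = 0 in ℤₚ then z = 0.
  p^-cancel : ∀ c z → (∀ n → P n ∣ P c * approx z n) → ∀ n → P n ∣ approx z n
  p^-cancel c z h n = ∣approx⇒∣ₚ z (ℕ.m≤n+m n c) (P∣-cancel c n (h (c ℕ.+ n)))

  -- Truncation and the floor

  -- The first n digits of z spell the least nonnegative residue of z modulo pⁿ. A mere
  -- congruence would not suffice for the induction, which compares it with a remainder.
  truncate≡%ℕ : ∀ z n → truncate z n ≡ (approx z n %ℕ (p ℕ.^ n)) {{p^n≢0 n}}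
  truncate≡%ℕ z zero    = sym (ℕ.n<1⇒n≡0 (n%ℕd<d (approx z 0) 1))
  truncate≡%ℕ z (suc n) = begin
    truncate z n ℕ.+ digit z n ℕ.* p ℕ.^ n        ≡⟨ cong (ℕ._+ digit z n ℕ.* p ℕ.^ n) lower ⟩
    r ℕ.% (p ℕ.^ n) ℕ.+ digit z n ℕ.* p ℕ.^ n     ≡⟨ ℕ.m≡m%n+[m/n]*n r (p ℕ.^ n) ⟨
    r                                              ∎
    where
    open ≡-Reasoning
    instance
      _ = p^n≢0 n
      _ = p^n≢0 (suc n)
    r = approx z (suc n) %ℕ (p ℕ.^ suc n)

    identity : ∀ r w s → r - s ≡ ((r + w) - s) - w
    identity = solve-∀

    r≡ : + r ≡ approx z n [mod P n ]
    r≡ = ∣-resp-≡ (identity (+ r) (w * P (suc n)) (approx z n))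
      (∣m∣n⇒∣m-n
        (subst (λ a → a ≡ approx z n [mod P n ])
          (a≡a%ℕn+[a/ℕn]*n (approx z (suc n)) (p ℕ.^ suc n))
          (coherent z n))
        (∣n⇒∣m*n w (P∣P (ℕ.n≤1+n n))))
      where w = approx z (suc n) /ℕ (p ℕ.^ suc n)

    lower : truncate z n ≡ r ℕ.% (p ℕ.^ n)
    lower = trans (truncate≡%ℕ z n) (sym (%ℕ-cong (+ r) (approx z n) (p ℕ.^ n) r≡))

  truncate-correct : ∀ z n → approx z n ≡ + truncate z n [mod P n ]
  truncate-correct z n = subst (λ t → approx z n ≡ + t [mod P n ]) (sym (truncate≡%ℕ z n))
    (∣-resp-≡ (trans (cong (_- + r) (a≡a%ℕn+[a/ℕn]*n (approx z n) (p ℕ.^ n))) (identity (+ r) _))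
      (∣n⇒∣m*n (approx z n /ℕ (p ℕ.^ n)) ∣-refl))
    where
    instance _ = p^n≢0 n
    r = approx z n %ℕ (p ℕ.^ n)

    identity : ∀ r w → (r + w) - r ≡ w
    identity = solve-∀

  -- Recurrence of the complete quotients

  -- Write αₙ = xₙ / qₙ, where qₙ is a power of p; then the floor is aₙ = tₙ / qₙ with an
  -- integer tₙ ≥ 0. So an expansion becomes a sequence of p-adic integers xₙ tied together by
  -- integer coefficients.
  module Expansion {α : ℚₚ} (e : InfiniteRubanExpansion α) where

    x : ℕ → ℤₚ
    x n = numₚ (complete e n)

    k : ℕ → ℕ
    k n = expₚ (complete e n)

    q : ℕ → ℤ
    q n = P (k n)

    -- The digits of xₙ with index at most k n are those of αₙ with exponent at most 0.
    t : ℕ → ℤ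
    t n = + truncate (x n) (suc (k n))

    -- αₙ - aₙ has positive valuation: its digits are those of αₙ with positive exponent.
    tail-divisible : ∀ n {N} → suc (k n) ℕ.≤ N → P (suc (k n)) ∣ approx (x n) N - t n
    tail-divisible n {N} k<N =
      ∣-resp-≡ (identity (approx (x n) N) (approx (x n) (suc (k n))) (t n))
        (∣m∣n⇒∣m+n (approx-stable (x n) k<N) (truncate-correct (x n) (suc (k n))))
      where
      identity : ∀ a b c → a - c ≡ (a - b) + (b - c)
      identity = solve-∀

    -- (xₙ - tₙ) xₙ₊₁ = qₙ qₙ₊₁ in ℤₚ, a common factor qₙ having been cancelled.
    recurrence : ∀ n N →
      P N ∣ (approx (x n) N - t n) * approx (x (suc n)) N - q n * q (suc n)
    recurrence n = p^-cancel (k n)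
      (((x n) +ℤₚ (-ℤₚ constℤₚ (t n))) *ℤₚ x (suc n) +ℤₚ (-ℤₚ constℤₚ (q n * q (suc n))))
      λ N → ∣-resp-≡
        (trans (identity (q n) (approx (x n) N) (t n) (approx (x (suc n)) N) (q (suc n)))
          (cong (λ c → P 0 * ((q n * approx (x n) N + q n * (- t n)) * approx (x (suc n)) N)
                       - c * 1ℤ)
            (sym (trans (P-+ (k n ℕ.+ k n) (k (suc n))) (cong (_* q (suc n)) (P-+ (k n) (k n)))))))
        (step e n N)
      where
      identity : ∀ q x t x′ q′ → q * ((x + - t) * x′ + - (q * q′)) ≡
        1ℤ * ((q * x + q * (- t)) * x′) - q * q * q′ * 1ℤ
      identity = solve-∀

    -- For n ≥ 1 the partial quotient aₙ is not zero, since αₙ = 1 / (αₙ₋₁ - aₙ₋₁) has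
    -- negative valuation. If tₙ were 0, then (xₙ₋₁ - tₙ₋₁) xₙ would be divisible
    -- by p² qₙ₋₁ qₙ, but it equals qₙ₋₁ qₙ.
    0<t : ∀ n → 0ℤ < t (suc n)
    0<t n = positive (truncate (x (suc n)) (suc (k (suc n)))) λ t≡0 →
      ℕ.<⇒≱ (ℕ.^-monoʳ-< p 1<p lt) (ℕ.∣⇒≤ {{p^n≢0 (k n ℕ.+ k (suc n))}}
        (∣⇒∣ᵤ (subst (P N ∣_) (sym (P-+ (k n) (k (suc n)))) (divides-q t≡0))))
      where
      N = suc (k n) ℕ.+ suc (k (suc n))

      lt : k n ℕ.+ k (suc n) ℕ.< N
      lt = ℕ.+-mono-<-≤ (ℕ.n<1+n (k n)) (ℕ.n≤1+n (k (suc n)))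

      positive : ∀ m → ¬ m ≡ 0 → 0ℤ < + m
      positive zero    m≢0 = ⊥-elim (m≢0 refl)
      positive (suc m) _   = +<+ (ℕ.s≤s ℕ.z≤n)

      identity : ∀ u x′ r → r ≡ u * x′ - (u * x′ - r)
      identity = solve-∀

      identity₀ : ∀ a → a ≡ a - 0ℤ
      identity₀ = solve-∀

      divides-q : truncate (x (suc n)) (suc (k (suc n))) ≡ 0 → P N ∣ q n * q (suc n)
      divides-q t≡0 = ∣-resp-≡
        (identity (approx (x n) N - t n) (approx (x (suc n)) N) (q n * q (suc n)))
        (∣m∣n⇒∣m-n
          (P∣-* (suc (k n)) (suc (k (suc n))) (tail-divisible n (ℕ.m≤m+n _ _))
            (∣-resp-≡ (trans (identity₀ (approx (x (suc n)) N))
                             (cong (λ t → approx (x (suc n)) N - + t) (sym t≡0)))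
              (tail-divisible (suc n) (ℕ.m≤n+m _ (suc (k n))))))
          (recurrence n N))

  -- An expansion is determined by its partial quotients

  module _ {α β : ℚₚ} (e : InfiniteRubanExpansion α) (f : InfiniteRubanExpansion β) where
    open Expansion e
    open Expansion f using () renaming
      (x to y; k to l; q to r; t to s; tail-divisible to tail-divisible′; recurrence to recurrence′)

    partialQuotients-agree : ∀ n → partialQuotient e n ≡ partialQuotient f n →
                             t n * r n ≡ s n * q n
    partialQuotients-agree n eq = begin
      t n * r n                             ≡⟨ ℤ.pos-* T (p ℕ.^ l n) ⟨
      + (T ℕ.* p ℕ.^ l n)                   ≡⟨ cong +_ cross-multiplied ⟩
      + (S ℕ.* p ℕ.^ k n)                   ≡⟨ ℤ.pos-* S (p ℕ.^ k n) ⟩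
      s n * q n                             ∎
      where
      open ≡-Reasoning
      T = truncate (x n) (suc (k n))
      S = truncate (y n) (suc (l n))

      cross-multiplied : T ℕ.* p ℕ.^ l n ≡ S ℕ.* p ℕ.^ k n
      cross-multiplied =
        ℚ.normalize-injective-≃ T S _ _ {{p^n≢0 (k n)}} {{p^n≢0 (l n)}} eq

    module _ (same : ∀ n → partialQuotient e n ≡ partialQuotient f n) where

      -- The numerator of αₙ - βₙ over the denominator qₙ rₙ.
      difference : ℕ → ℤₚ
      difference n = (p^ l n · x n) +ℤₚ (-ℤₚ (p^ k n · y n))

      -- The valuation of αₙ - βₙ is at least M, for every M. As αₙ and βₙ have the same floor
      -- aₙ, taking inverses gives αₙ - βₙ = (αₙ - aₙ) (βₙ - aₙ) (βₙ₊₁ - αₙ₊₁), where the first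
      -- two factors have positive valuation. So a bound for all differences at once improves
      -- itself.
      difference-divisible : ∀ M n → p^ (k n ℕ.+ l n ℕ.+ M) ∣ₚ difference n
      difference-divisible zero n = ∣approx⇒∣ₚ (difference n) {N = N}
        (ℕ.≤-trans (ℕ.≤-reflexive (ℕ.+-identityʳ (k n ℕ.+ l n))) kl≤N)
        (subst (λ a → P a ∣ approx (difference n) N) (sym (ℕ.+-identityʳ (k n ℕ.+ l n)))
        (∣-resp-≡ (identity (q n) (r n) (approx (x n) N) (approx (y n) N) (t n) (s n))
          (∣m∣n⇒∣m+n
            (∣m∣n⇒∣m-n
              (∣-trans (P∣P {k n ℕ.+ l n} {suc (k n) ℕ.+ l n} (ℕ.+-monoˡ-≤ (l n) (ℕ.n≤1+n (k n))))
                (P∣-* (suc (k n)) (l n) (tail-divisible n (ℕ.m≤m+n _ _)) ∣-refl))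
              (∣-trans (P∣P {k n ℕ.+ l n} {k n ℕ.+ suc (l n)} (ℕ.+-monoʳ-≤ (k n) (ℕ.n≤1+n (l n))))
                (P∣-* (k n) (suc (l n)) ∣-refl (tail-divisible′ n (ℕ.m≤n+m _ (suc (k n)))))))
            (≡⇒∣- (partialQuotients-agree n (same n))))))
        where
        N = suc (k n) ℕ.+ suc (l n)

        kl≤N : k n ℕ.+ l n ℕ.≤ N
        kl≤N = ℕ.+-mono-≤ (ℕ.n≤1+n (k n)) (ℕ.n≤1+n (l n))

        identity : ∀ q r x y t s → r * x - q * y ≡ ((x - t) * r - q * (y - s)) + (t * r - s * q)
        identity = solve-∀
      difference-divisible (suc M) n = ∣approx⇒∣ₚ (difference n) {N = N}
        (ℕ.≤-trans L′≤L (ℕ.≤-trans (ℕ.m≤n+m L S) (ℕ.≤-reflexive S+L≡N)))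
        (∣-trans (P∣P L′≤L)
          (P∣-cancel S L (subst (λ a → P a ∣ P S * approx (difference n) N) (sym S+L≡N)
            (∣-resp-≡ expand
              (∣m∣n⇒∣m+n
                (∣m∣n⇒∣m-n
                  (∣m∣n⇒∣m-n
                    (∣n⇒∣m*n (q n * r n * r (suc n) * v) (recurrence n N))
                    (∣n⇒∣m*n (q n * r n * q (suc n) * u) (recurrence′ n N)))
                  main)
                (∣n⇒∣m*n (q n * q (suc n) * (r n * r (suc n)))
                  (≡⇒∣- (partialQuotients-agree n (same n)))))))))
        where
        -- P S is the product of all four denominators, by which the recurrences multiply the
        -- difference; L is the exponent gained, which exceeds the required one by 1.
        S = (k n ℕ.+ k (suc n)) ℕ.+ (l n ℕ.+ l (suc n))
        L = k n ℕ.+ l n ℕ.+ suc (suc M)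
        N = (k n ℕ.+ l n) ℕ.+ ((suc (k n) ℕ.+ suc (l n)) ℕ.+ (k (suc n) ℕ.+ l (suc n) ℕ.+ M))

        L′≤L : k n ℕ.+ l n ℕ.+ suc M ℕ.≤ L
        L′≤L = ℕ.+-monoʳ-≤ (k n ℕ.+ l n) (ℕ.n≤1+n (suc M))

        S+L≡N : S ℕ.+ L ≡ N
        S+L≡N = identity (k n) (l n) (k (suc n)) (l (suc n)) M
          where
          identity : ∀ a b c d m → (a ℕ.+ c) ℕ.+ (b ℕ.+ d) ℕ.+ (a ℕ.+ b ℕ.+ suc (suc m)) ≡
            (a ℕ.+ b) ℕ.+ ((suc a ℕ.+ suc b) ℕ.+ (c ℕ.+ d ℕ.+ m))
          identity = ℕRing.solve-∀

        u = approx (x n) N - t n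
        v = approx (y n) N - s n

        -- The term (αₙ - aₙ) (βₙ - aₙ) (βₙ₊₁ - αₙ₊₁), up to sign and denominators.
        main : P N ∣ (q n * r n) * ((u * v) * approx (difference (suc n)) N)
        main = P∣-* (k n ℕ.+ l n) _ (subst (_∣ q n * r n) (sym (P-+ (k n) (l n))) ∣-refl)
          (P∣-* (suc (k n) ℕ.+ suc (l n)) _
            (P∣-* (suc (k n)) (suc (l n)) (tail-divisible n k<N) (tail-divisible′ n l<N))
            (∣ₚ⇒∣approx (difference (suc n))
              (ℕ.≤-trans (ℕ.m≤n+m _ (suc (k n) ℕ.+ suc (l n))) (ℕ.m≤n+m _ (k n ℕ.+ l n)))
              (difference-divisible M (suc n))))
          where
          k<N : suc (k n) ℕ.≤ N
          k<N = ℕ.≤-trans (ℕ.m≤m+n _ _) (ℕ.≤-trans (ℕ.m≤m+n _ _) (ℕ.m≤n+m _ (k n ℕ.+ l n)))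

          l<N : suc (l n) ℕ.≤ N
          l<N = ℕ.≤-trans (ℕ.m≤n+m _ (suc (k n))) (ℕ.≤-trans (ℕ.m≤m+n _ _) (ℕ.m≤n+m _ (k n ℕ.+ l n)))

        P-S : P S ≡ q n * q (suc n) * (r n * r (suc n))
        P-S = trans (P-+ (k n ℕ.+ k (suc n)) (l n ℕ.+ l (suc n)))
          (cong₂ _*_ (P-+ (k n) (k (suc n))) (P-+ (l n) (l (suc n))))

        identity : ∀ q q′ r r′ x x′ y y′ t s →
          q * q′ * (r * r′) * (r * x - q * y) ≡
            (q * r * r′ * (y - s) * ((x - t) * x′ - q * q′)
             - q * r * q′ * (x - t) * ((y - s) * y′ - r * r′)
             - (q * r) * ((x - t) * (y - s) * (r′ * x′ - q′ * y′)))
            + q * q′ * (r * r′) * (t * r - s * q)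
        identity = solve-∀

        expand : P S * approx (difference n) N ≡
            (q n * r n * r (suc n) * v * (u * approx (x (suc n)) N - q n * q (suc n))
             - q n * r n * q (suc n) * u * (v * approx (y (suc n)) N - r n * r (suc n))
             - (q n * r n) * ((u * v) * approx (difference (suc n)) N))
            + q n * q (suc n) * (r n * r (suc n)) * (t n * r n - s n * q n)
        expand = trans (cong (_* approx (difference n) N) P-S)
          (identity (q n) (q (suc n)) (r n) (r (suc n)) (approx (x n) N) (approx (x (suc n)) N)
            (approx (y n) N) (approx (y (suc n)) N) (t n) (s n))

      complete₀-unique : complete e 0 ≈ complete f 0
      complete₀-unique N = ∣approx⇒∣ₚ (difference 0) ℕ.≤-refl
        (∣ₚ-weaken (difference 0) (ℕ.m≤n+m N (k 0 ℕ.+ l 0)) (difference-divisible N 0))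

  -- The expansion of the m-th complete quotient.
  tail : {α : ℚₚ} (e : InfiniteRubanExpansion α) (m : ℕ) → InfiniteRubanExpansion (complete e m)
  tail e m .complete n = complete e (n ℕ.+ m)
  tail e m .start    N = ≡⇒∣- {P (expₚ (complete e m)) * approx (numₚ (complete e m)) N} refl
  tail e m .step     n = step e (n ℕ.+ m)

  -- Integral Möbius relations and quadratic equations

  -- A relation z = (A z′ + B) / (C z′ + E), freed of denominators, with integer coefficients
  -- of the signs that arise when complete quotients are expanded.
  record PositiveMöbius (z z′ : ℤₚ) : Set where
    field
      A B C E  : ℤ
      0<A      : 0ℤ < A
      0<B      : 0ℤ < B
      0<C      : 0ℤ < C
      0≤E      : 0ℤ ≤ E
      relation : ∀ N → P N ∣ approx z N * (C * approx z′ N + E) - (A * approx z′ N + B)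

  -- z is a root of an integer quadratic polynomial of positive discriminant. The leading
  -- coefficient may be zero, which makes the property stable under indefiniteRoot-step.
  record IndefiniteRoot (z : ℤₚ) : Set where
    field
      a b c  : ℤ
      0<disc : 0ℤ < disc a b c
      root   : ∀ N → P N ∣ c * (approx z N * approx z N) + b * approx z N + a

  -- In this module z = T + Q / z′, as for consecutive complete quotients.
  module _ {z z′ : ℤₚ} {T Q : ℤ} (0<Q : 0ℤ < Q)
           (h : ∀ N → P N ∣ (approx z N - T) * approx z′ N - Q) where

    möbius-step : 0ℤ < T → PositiveMöbius z z′
    möbius-step 0<T = record
      { A = T ; B = Q ; C = 1ℤ ; E = 0ℤ
      ; 0<A = 0<T ; 0<B = 0<Q ; 0<C = +<+ (ℕ.s≤s ℕ.z≤n) ; 0≤E = +≤+ ℕ.z≤n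
      ; relation = λ N → ∣-resp-≡ (identity (approx z N) (approx z′ N) T Q) (h N)
      }
      where
      identity : ∀ z z′ T Q → z * (1ℤ * z′ + 0ℤ) - (T * z′ + Q) ≡ (z - T) * z′ - Q
      identity = solve-∀

    möbius-compose : ∀ {z″} → 0ℤ < T → PositiveMöbius z′ z″ → PositiveMöbius z z″
    möbius-compose {z″} 0<T g = record
      { A = T * A + Q * C ; B = T * B + Q * E ; C = A ; E = B
      ; 0<A = ℤ.+-mono-< (0<i*j 0<T 0<A) (0<i*j 0<Q 0<C)
      ; 0<B = ℤ.+-mono-<-≤ (0<i*j 0<T 0<B) (0≤i*j (ℤ.<⇒≤ 0<Q) 0≤E)
      ; 0<C = 0<A ; 0≤E = ℤ.<⇒≤ 0<B
      ; relation = λ N → ∣-resp-≡ (identity (approx z N) (approx z′ N) (approx z″ N) T Q A B C E)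
          (∣m∣n⇒∣m-n (∣n⇒∣m*n (C * approx z″ N + E) (h N))
                     (∣n⇒∣m*n (approx z N - T) (relation N)))
      }
      where
      open PositiveMöbius g
      identity : ∀ z z′ z″ T Q A B C E →
        z * (A * z″ + B) - ((T * A + Q * C) * z″ + (T * B + Q * E)) ≡
          (C * z″ + E) * ((z - T) * z′ - Q) - (z - T) * (z′ * (C * z″ + E) - (A * z″ + B))
      identity = solve-∀

    -- The substitution z′ = Q / (z - T) multiplies the discriminant by Q².
    indefiniteRoot-step : IndefiniteRoot z′ → IndefiniteRoot z
    indefiniteRoot-step g = record
      { a = c * (Q * Q) - b * Q * T + a * (T * T) ; b = b * Q - + 2 * (a * T) ; c = a
      ; 0<disc = subst (0ℤ <_) (disc-identity a b c Q T) (0<i*j (0<i*j 0<Q 0<Q) 0<disc)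
      ; root = λ N → ∣-resp-≡ (identity (approx z N) (approx z′ N) T Q a b c)
          (∣m∣n⇒∣m-n (∣n⇒∣m*n ((approx z N - T) * (approx z N - T)) (root N))
            (∣n⇒∣m*n (c * ((approx z N - T) * approx z′ N + Q) + b * (approx z N - T)) (h N)))
      }
      where
      open IndefiniteRoot g
      disc-identity : ∀ a b c Q T → (Q * Q) * (b * b - + 4 * (a * c)) ≡
        (b * Q - + 2 * (a * T)) * (b * Q - + 2 * (a * T))
          - + 4 * ((c * (Q * Q) - b * Q * T + a * (T * T)) * a)
      disc-identity = solve-∀
      identity : ∀ z z′ T Q a b c →
        a * (z * z) + (b * Q - + 2 * (a * T)) * z + (c * (Q * Q) - b * Q * T + a * (T * T)) ≡
          (z - T) * (z - T) * (c * (z′ * z′) + b * z′ + a)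
            - (c * ((z - T) * z′ + Q) + b * (z - T)) * ((z - T) * z′ - Q)
      identity = solve-∀

  -- If z and z′ are proportional, the Möbius relation is a quadratic equation for z. Its
  -- discriminant is a square plus a positive multiple of B C.
  möbius-fixed : ∀ {z z′ q q′} → 0ℤ < q → 0ℤ < q′ → PositiveMöbius z z′ →
    (∀ N → P N ∣ q′ * approx z N - q * approx z′ N) → IndefiniteRoot z
  möbius-fixed {z} {z′} {q} {q′} 0<q 0<q′ g h = record
    { a = - (B * q) ; b = E * q - A * q′ ; c = C * q′
    ; 0<disc = subst (0ℤ <_) (disc-identity A B C E q q′)
        (ℤ.+-mono-≤-< (0≤i*i (E * q - A * q′))
          (0<i*j {+ 4} (+<+ (ℕ.s≤s ℕ.z≤n)) (0<i*j (0<i*j 0<B 0<q) (0<i*j 0<C 0<q′))))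
    ; root = λ N → ∣-resp-≡ (identity (approx z N) (approx z′ N) A B C E q q′)
        (∣m∣n⇒∣m+n (∣n⇒∣m*n q (relation N)) (∣n⇒∣m*n (C * approx z N - A) (h N)))
    }
    where
    open PositiveMöbius g
    disc-identity : ∀ A B C E q q′ →
      (E * q - A * q′) * (E * q - A * q′) + + 4 * (B * q * (C * q′)) ≡
        (E * q - A * q′) * (E * q - A * q′) - + 4 * (- (B * q) * (C * q′))
    disc-identity = solve-∀
    identity : ∀ z z′ A B C E q q′ →
      C * q′ * (z * z) + (E * q - A * q′) * z + - (B * q) ≡
        q * (z * (C * z′ + E) - (A * z′ + B)) + (C * z - A) * (q′ * z - q * z′)
    identity = solve-∀

  -- A square root z of a negative integer g is no root of such a polynomial. From z² = g
  -- the equation becomes w + b z = 0 with w = c g + a, so the integer w² - b² g =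
  -- (w + b z) (w - b z) is zero in ℤₚ and hence in ℤ.
  indefiniteRoot-square≮0 : ∀ {z g} → IndefiniteRoot z →
    (∀ N → P N ∣ approx z N * approx z N - g) → ¬ g < 0ℤ
  indefiniteRoot-square≮0 {z} {g} r h g<0 = conjugate-roots⇒disc≤0 a b c g g<0
    (ℤ.i-j≡0⇒i≡j _ _ (P∣-all⇒≡0 λ N → ∣-resp-≡ (identity (approx z N) a b c g)
      (∣m∣n⇒∣m+n
        (∣n⇒∣m*n (c * g + a - b * approx z N) (root N))
        (∣n⇒∣m*n (b * b - c * (c * g + a - b * approx z N)) (h N)))))
    0<disc
    where
    open IndefiniteRoot r
    identity : ∀ z a b c g → (c * g + a) * (c * g + a) - b * b * g ≡
      (c * g + a - b * z) * (c * (z * z) + b * z + a)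
        + (b * b - c * (c * g + a - b * z)) * (z * z - g)
    identity = solve-∀

  -- Periodic expansions

  module _ {α : ℚₚ} (e : InfiniteRubanExpansion α) where
    open Expansion e

    -- The relation starts at index n + 1 because a₀ may be zero.
    tail-möbius : ∀ d n → PositiveMöbius (x (suc n)) (x (suc d ℕ.+ suc n))
    tail-möbius zero    n =
      möbius-step (0<i*j (0<P (k (suc n))) (0<P (k (2 ℕ.+ n)))) (recurrence (suc n)) (0<t n)
    tail-möbius (suc d) n =
      subst (λ m → PositiveMöbius (x (suc n)) (x (suc m))) (ℕ.+-suc d (suc n))
        (möbius-compose (0<i*j (0<P (k (suc n))) (0<P (k (2 ℕ.+ n)))) (recurrence (suc n)) (0<t n)
          (tail-möbius d (suc n)))

    indefiniteRoot-0 : ∀ n → IndefiniteRoot (x n) → IndefiniteRoot (x 0)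
    indefiniteRoot-0 zero    r = r
    indefiniteRoot-0 (suc n) r = indefiniteRoot-0 n
      (indefiniteRoot-step (0<i*j (0<P (k n)) (0<P (k (suc n)))) (recurrence n) r)

    periodic⇒indefiniteRoot : ∀ K d →
      (∀ n → K ℕ.≤ n → partialQuotient e (n ℕ.+ suc d) ≡ partialQuotient e n) →
      IndefiniteRoot (x 0)
    periodic⇒indefiniteRoot K d periodic = indefiniteRoot-0 (suc K)
      (möbius-fixed (0<P (k (suc K))) (0<P (k (suc d ℕ.+ suc K))) (tail-möbius d K)
        (complete₀-unique (tail e (suc K)) (tail e (suc d ℕ.+ suc K)) same))
      where
      identity : ∀ n m d → n ℕ.+ m ℕ.+ d ≡ n ℕ.+ (d ℕ.+ m)
      identity = ℕRing.solve-∀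

      same : ∀ n → partialQuotient e (n ℕ.+ suc K) ≡ partialQuotient e (n ℕ.+ (suc d ℕ.+ suc K))
      same n = trans
        (sym (periodic (n ℕ.+ suc K) (ℕ.≤-trans (ℕ.n≤1+n K) (ℕ.m≤n+m (suc K) n))))
        (cong (partialQuotient e) (identity n (suc K) (suc d)))

    -- Whatever representatives are chosen, x₀² = D q₀² in ℤₚ if α² = D.
    square-start : ∀ D → (α ℚₚ′.* α) ≈ fromℤ D →
      ∀ N → P N ∣ approx (x 0) N * approx (x 0) N - D * (q 0 * q 0)
    square-start D αα≈D = p^-cancel (s ℕ.+ s)
      (x 0 *ℤₚ x 0 +ℤₚ (-ℤₚ constℤₚ (D * (q 0 * q 0)))) λ N →
      ∣-resp-≡
        (trans (cong (_* (approx (x 0) N * approx (x 0) N - D * (q 0 * q 0))) (P-+ s s))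
          (trans (identity (approx (x 0) N) (approx y N) (q 0) (P s) D)
            (cong (λ w → (P s * approx (x 0) N + q 0 * approx y N)
                           * (P s * approx (x 0) N - q 0 * approx y N)
                         + q 0 * q 0 * (1ℤ * (approx y N * approx y N) - w * D))
              (sym (P-+ s s)))))
        (∣m∣n⇒∣m+n
          (∣n⇒∣m*n (P s * approx (x 0) N + q 0 * approx y N) (start e N))
          (∣n⇒∣m*n (q 0 * q 0) (αα≈D N)))
      where
      y = numₚ α
      s = expₚ α
      identity : ∀ x y q w D → w * w * (x * x - D * (q * q)) ≡
        (w * x + q * y) * (w * x - q * y) + q * q * (1ℤ * (y * y) - w * w * D)
      identity = solve-∀

  negative-square⇒¬periodic : ∀ D α → (α ℚₚ′.* α) ≈ fromℤ D → D < 0ℤ →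
    ¬ HasUltimatelyPeriodicRubanExpansion α
  negative-square⇒¬periodic D α αα≈D D<0 (e , K , suc d , _ , periodic) =
    indefiniteRoot-square≮0 (periodic⇒indefiniteRoot e K d periodic) (square-start e D αα≈D)
      (subst (D * (q 0 * q 0) <_) (ℤ.*-zeroˡ (q 0 * q 0))
        (ℤ.*-monoʳ-<-pos (q 0 * q 0) {{ℤ.positive (0<i*j (0<P (k 0)) (0<P (k 0)))}} D<0))
    where open Expansion e

corollary2p3 : (p : ℕ) (p-prime : Prime p) (D : ℤ) →
    ¬ IsPerfectSquare D →
    (¬ (2 ∣ℕ p) → IsQuadraticResidue D (+ p) × ¬ (+ p ∣ D)) →
    (p ≡ 2 → D ≡ 1ℤ [mod + 8 ]) →
    let open PAdic p p-prime in
    (√D : ℚₚ) → √D * √D ≈ fromℤ D →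
    D < 0ℤ →
    ¬ HasUltimatelyPeriodicRubanExpansion √D
corollary2p3 p p-prime D _ _ _ √D = PAdicLemmas.negative-square⇒¬periodic p p-prime D √D
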